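{- Let $\Delta\ \mathsf{ctx_{Kan}}\,[\Psi]$. For any value $\Delta$-indexed $\Psi$-PER $\alpha$, $\psi:\Psi'\to\Psi$, and dimension terms $r,r'$ over $\Psi'$, if (1) $\overline I\doteq\overline I'\in\Delta\psi\,[\Psi',z]$, (2) $\mathrm{Tm}(\alpha_\psi[\overline I\langle r/z\rangle])(M,M')$, then (a) $\mathrm{Tm}(\alpha_\psi[\overline I\langle r'/z\rangle])(\mathsf{fcoe}_{z.\overline I}^{r\rightsquigarrow r'}(M),M)$ when $\overline I=\varnothing$, (b) $\mathrm{Tm}(\alpha_\psi[\overline I\langle r'/z\rangle])_{\mathrm{id}\mid r=r'}(\mathsf{fcoe}_{z.\overline I}^{r\rightsquigarrow r'}(M),M)$, (c) $\mathrm{Tm}((\alpha\cup\mathrm{Fcoe}(\alpha))_\psi[\overline I\langle r'/z\rangle])(\mathsf{fcoe}_{z.\overline I}^{r\rightsquigarrow r'}(M),\mathsf{fcoe}_{z.\overline I'}^{r\rightsquigarrow r'}(M'))$.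
   Context: \textbf{Programs.} Fix a cubical operational semantics: a grammar of terms with variable binding, possibly containing dimension terms, with judgments $V\ \mathsf{val}$ and deterministic $M\mapsto M'$ on terms without free term variables (values do not step); $M\Downarrow V$ means $M\mapsto^*V$ and $V\ \mathsf{val}$. A dimension term is $0$, $1$ or a dimension variable; a dimension context $\Psi$ is a finite list of dimension variables; a $\Psi$-term has its free dimension variables in $\Psi$. A substitution $\psi:\Psi'\to\Psi$ assigns to each $x\in\Psi$ a dimension term over $\Psi'$; $M\psi$ is the substituted term, $M(\psi\psi')=(M\psi)\psi'$, and $\langle r/x\rangle$ replaces $x$ by $r$. A constraint $\xi$ is a formal equation $r=r'$ of dimension terms; $\models\xi$ iff $r,r'$ are the same; $\models\Xi$ for a list $\Xi$ iff all members hold. $\Xi$ is valid if some member holds or, for some $r$, it contains both $r=0$ and $r=1$. Overlines denote finite lists; in $\overline{\xi_i\hookrightarrow y.N_i}$ the variable $y$ is bound in $N_i$. $\varnothing$ is the empty list. \textbf{$\Psi$-relations.} A $\Psi$-relation $\alpha$ gives, for each $\psi:\Psi'\to\Psi$, a binary relation $\alpha_\psi$ on $\Psi'$-terms without free term variables. It is a value relation if it relates only values, a $\Psi$-PER if all $\alpha_\psi$ are symmetric and transitive. $\alpha(M,M')$ means $\alpha_{\mathrm{id}}(M,M')$; $(\alpha\psi)_{\psi'}=\alpha_{\psi\psi'}$; $\alpha_\psi\{M_1,\dots,M_n\}$ means $\alpha_\psi(M_i,M_j)$ for all $i,j$. $\alpha_{\psi\mid\Xi}(M,M')$ means $\alpha_{\psi\psi'}(M\psi',M'\psi')$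 for all $\psi'$ into the domain of $\psi$ with $\models\Xi\psi'$. For a value $\Psi$-relation $\alpha$, $\mathrm{Tm}(\alpha)_\psi(M,M')$ holds (for $\psi:\Psi'\to\Psi$) iff for all $\psi_1:\Psi_1\to\Psi'$, $\psi_2:\Psi_2\to\Psi_1$ there are terms with $M\psi_1\Downarrow M_1$, $M_1\psi_2\Downarrow M_2$, $M\psi_1\psi_2\Downarrow M_{12}$, $M'\psi_1\Downarrow M_1'$, $M_1'\psi_2\Downarrow M_2'$, $M'\psi_1\psi_2\Downarrow M_{12}'$ and, for $\chi=\psi\psi_1\psi_2$, $\alpha_\chi(M_2,M_2')$, $\alpha_\chi\{M_2,M_{12}\}$, $\alpha_\chi\{M_2',M'_{12}\}$. $\alpha$ is value-coherent if $\alpha_\psi(V,V')$ implies $\mathrm{Tm}(\alpha)_\psi(V,V')$. \textbf{Index contexts.} A candidate cubical type system $\tau(\Psi,A_0,A_0',\varphi)$ (relating $\Psi$-term values $A_0,A_0'$ and a relation $\varphi$ on $\Psi$-term values) is fixed. $\mathrm{PTy}(\tau)(\Psi,A,A',\alpha)$, for a value $\Psi$-relation $\alpha$, holds iff for all $\psi_1:\Psi_1\to\Psi,\psi_2:\Psi_2\to\Psi_1$ there are $A\psi_1\Downarrow A_1$, $A_1\psi_2\Downarrow A_2$, $A\psi_1\psi_2\Downarrow A_{12}$ and likewise $A'_1,A_2',A_{12}'$ from $A'$ with $\tau(\Psi_2,B,B',\alpha_{\psi_1\psi_2})$ for $(B,B')=(A_2,A_2')$, for all $B,B'\in\{A_2,A_{12}\}$,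 and for all $B,B'\in\{A_2',A_{12}'\}$. $\tau$ is a cubical type system: $\varphi$ is determined by $(\Psi,A,A')$ and is a PER, each $\tau(\Psi,-,-,\varphi)$ is a PER, and $\tau(\Psi,A,A',\varphi)$ implies $\mathrm{PTy}(\tau)(\Psi,A,A',\alpha)$ for some $\alpha$. $A\doteq A'\ \mathsf{type_{pre}}\,[\Psi]$ iff $\mathrm{PTy}(\tau)(\Psi,A,A',\alpha)$ with $\alpha$ value-coherent (written $[\![A]\!]$); $M\doteq M'\in A\,[\Psi]$ iff $\mathrm{Tm}([\![A]\!])(M,M')$; unary forms are reflexive instances. Contexts (telescopes) $\Delta$, lists $\overline I\doteq\overline I'\in\Delta$, and open judgments are defined by functionality: an open judgment holds iff all its instances under dimension substitutions and equal closing lists hold. $\mathsf{ctx_{Kan}}$ requires the types to be Kan, i.e. closed under the composition operator $\mathsf{hcom}$ and the coercion operator $\mathsf{coe}$: $A\doteq A'$ are Kan if, with $\alpha=[\![A]\!]$, (hcom) for all $\psi:\Psi'\to\Psi$, $r,r'$, valid $\overline{\xi_i}$, $\mathrm{Tm}(\alpha)_\psi(M,M')$, $N_i,N_j'$ related in $\mathrm{Tm}(\alpha)_{\psi\pi\mid\xi_i,\xi_j}$ (with $\pi:(\Psi',y)\to\Psi'$ the weakening) and $\mathrm{Tm}(\alpha)_{\psi\mid\xi_i}(N_i\langle r/y\rangle,M)$, the terms $H^{r'}=\mathsf{hcom}_{A\psi}^{r\rightsquigarrow r'}(M;\overline{\xi_i\hookrightarrow y.N_i})$ and $\mathsf{hcom}_{A'\psi}^{r\rightsquigarrow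 r'}(M';\overline{\xi_i\hookrightarrow y.N'_i})$ are related in $\mathrm{Tm}(\alpha)_\psi$, as are $H^r$ and $M$, and $\mathrm{Tm}(\alpha)_{\psi\mid\xi_i}(H^{r'},N_i\langle r'/y\rangle)$; (coe) for all $\psi:(\Psi',y)\to\Psi$, $r,r'$, $\mathrm{Tm}(\alpha)_{\psi\langle r/y\rangle}(M,M')$ implies $\mathrm{Tm}(\alpha)_{\psi\langle r'/y\rangle}(\mathsf{coe}_{y.A\psi}^{r\rightsquigarrow r'}(M),\mathsf{coe}_{y.A'\psi}^{r\rightsquigarrow r'}(M'))$ and $\mathrm{Tm}(\alpha)_{\psi\langle r/y\rangle}(\mathsf{coe}_{y.A\psi}^{r\rightsquigarrow r}(M),M)$. \textbf{Indexed relations.} A $\Delta$-indexed $\Psi$-relation $\alpha$ gives a $\Psi'$-relation $\alpha_\psi[\overline I]$ for each $\psi:\Psi'\to\Psi$ and $\overline I\in\Delta\psi\,[\Psi']$, with $\alpha_\psi[\overline I]\psi'=\alpha_{\psi\psi'}[\overline I\psi']$ and $\alpha_\psi[\overline I]=\alpha_\psi[\overline I']$ when $\overline I\doteq\overline I'\in\Delta\psi$; it is determined by identity components. It is a value relation or PER if all $\alpha_\psi[\overline I]$ are. Unions are componentwise. \textbf{fcoe.} $\mathsf{fcoe}_{z.\overline I}^{r\rightsquigarrow r'}(M)$ ($z$ bound in $\overline I$) steps to $M$ if $r=r'$ or $\overline I=\varnothing$; otherwise it is a value. $\mathrm{Fcoe}(\alpha)$ is the value $\Delta$-indexed $\Psi$-relation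 whose identity component at $\psi:\Psi'\to\Psi$ and $\overline I$ relates $\mathsf{fcoe}_{z.\overline J}^{r\rightsquigarrow r'}(M)$ and $\mathsf{fcoe}_{z.\overline J'}^{r\rightsquigarrow r'}(M')$ whenever $\overline J\ne\varnothing$, $r\ne r'$, $\overline J\doteq\overline J'\in\Delta\psi\,[\Psi',z]$, $\overline J\langle r'/z\rangle\doteq\overline I\in\Delta\psi\,[\Psi']$, and $\mathrm{Tm}(\alpha_\psi[\overline J\langle r/z\rangle])(M,M')$. -}

module Defs where

open import Level using (Level; _⊔_) renaming (suc to lsuc)
open import Data.Nat.Base using (ℕ; zero; suc; _+_; _*_)
open import Data.Fin.Base using (Fin; zero; suc; _↑ˡ_; _↑ʳ_; lift)
open import Data.List.Base as List using (List; []; _∷_)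
open import Data.List.Membership.Propositional using () renaming (_∈_ to _∈ˡ_)
open import Data.Vec.Base as Vec using (Vec; []; _∷_; lookup; tabulate)
open import Data.Vec.Relation.Unary.All using (All)
open import Data.Vec.Relation.Unary.Any using (Any)
open import Data.Vec.Membership.Propositional using (_∈_)
open import Data.Product.Base using (∃; ∃-syntax; _×_; _,_)
open import Data.Sum.Base using (_⊎_)
open import Function.Base using (_∘_)
open import Relation.Nullary.Negation.Core using (¬_)
open import Relation.Binary.Core using (Rel; _⇔_)
open import Relation.Binary.Structures using (IsPartialEquivalence)
open import Relation.Binary.PropositionalEquality.Core using (_≡_; _≢_)
open import Relation.Binary.Construct.Union using () renaming (_∪_ to _∪ᴿ_)
open import Relation.Binary.Construct.Closure.ReflexiveTransitive using (Star)

-- A dimension context is represented by its length Ψ (de Bruijn indices), so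
-- that (Ψ , y) is suc Ψ, with y the variable zero.

data Dim (Ψ : ℕ) : Set where
  𝟎 𝟏 : Dim Ψ
  var : Fin Ψ → Dim Ψ

-- Vectors rather than functions, so that substitutions agreeing on every
-- variable are propositionally equal.
Sub : ℕ → ℕ → Set
Sub Ψ′ Ψ = Vec (Dim Ψ′) Ψ

private variable
  Ψ Ψ′ Ψ″ : ℕ
  k m n : ℕ

_[_]ᵈ : Dim Ψ → Sub Ψ′ Ψ → Dim Ψ′
𝟎     [ ψ ]ᵈ = 𝟎
𝟏     [ ψ ]ᵈ = 𝟏
var x [ ψ ]ᵈ = lookup ψ x

infixl 9 _∙_
_∙_ : Sub Ψ′ Ψ → Sub Ψ″ Ψ′ → Sub Ψ″ Ψ
ψ ∙ ψ′ = Vec.map (_[ ψ′ ]ᵈ) ψ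

idˢ : Sub Ψ Ψ
idˢ = tabulate var

π : Sub (suc Ψ) Ψ
π = tabulate (var ∘ suc)

-- ⟨ r /y⟩ : Ψ → (Ψ , y)
⟨_/y⟩ : Dim Ψ → Sub Ψ (suc Ψ)
⟨ r /y⟩ = r ∷ idˢ

πs : ∀ d → Sub (d + Ψ) Ψ
πs zero    = idˢ
πs (suc d) = πs d ∙ π

liftˢ : ∀ d → Sub Ψ′ Ψ → Sub (d + Ψ′) (d + Ψ)
liftˢ zero    ψ = ψ
liftˢ (suc d) ψ = var zero ∷ (liftˢ d ψ ∙ π)

Constraint : ℕ → Set
Constraint Ψ = Dim Ψ × Dim Ψ

_[_]ᶜ : Constraint Ψ → Sub Ψ′ Ψ → Constraint Ψ′
(r , r′) [ ψ ]ᶜ = r [ ψ ]ᵈ , r′ [ ψ ]ᵈ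

Holds : Constraint Ψ → Set
Holds (r , r′) = r ≡ r′

⊨_ : Vec (Constraint Ψ) k → Set
⊨ Ξ = All Holds Ξ

Valid : Vec (Constraint Ψ) k → Set
Valid Ξ = Any Holds Ξ ⊎ ∃[ r ] ((r , 𝟎) ∈ Ξ × (r , 𝟏) ∈ Ξ)

-- The grammar is an arbitrary binding signature extended with hcom, coe and
-- fcoe. An operator takes #dims dimension terms and one term argument for each
-- entry (d , t) of binds, in which d dimension and t term variables are bound.
record Signature : Set₁ where
  field
    Op    : Set
    #dims : Op → ℕ
    binds : Op → List (ℕ × ℕ)

module Syntax (S : Signature) where
  open Signature S

  data Operator : Set where
    base  : Op → Operator
    hcomᵒ : (tubes : ℕ) → Operator
    coeᵒ  : Operator
    fcoeᵒ : (indices : ℕ) → Operator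

  dimsOf : Operator → ℕ
  dimsOf (base o)  = #dims o
  dimsOf (hcomᵒ k) = 2 + k * 2
  dimsOf coeᵒ      = 2
  dimsOf (fcoeᵒ k) = 2

  bindsOf : Operator → List (ℕ × ℕ)
  bindsOf (base o)  = binds o
  bindsOf (hcomᵒ k) = List.replicate k (1 , 0) List.++ (0 , 0) ∷ (0 , 0) ∷ []
  bindsOf coeᵒ      = (1 , 0) ∷ (0 , 0) ∷ []
  bindsOf (fcoeᵒ k) = List.replicate k (1 , 0) List.++ (0 , 0) ∷ []

  -- Term Ψ n: free dimension variables in Ψ and n free term variables.
  mutual
    data Term (Ψ n : ℕ) : Set where
      var : Fin n → Term Ψ n
      op  : (o : Operator) → Vec (Dim Ψ) (dimsOf o) → Args Ψ n (bindsOf o) → Term Ψ n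

    data Args (Ψ n : ℕ) : List (ℕ × ℕ) → Set where
      []  : Args Ψ n []
      _∷_ : ∀ {d t bs} → Term (d + Ψ) (t + n) → Args Ψ n bs → Args Ψ n ((d , t) ∷ bs)

  infixl 8 _[_] _[_]ₐ
  mutual
    _[_] : Term Ψ n → Sub Ψ′ Ψ → Term Ψ′ n
    var x     [ ψ ] = var x
    op o rs a [ ψ ] = op o (rs ∙ ψ) (a [ ψ ]ₐ)

    _[_]ₐ : ∀ {bs} → Args Ψ n bs → Sub Ψ′ Ψ → Args Ψ′ n bs
    []                [ ψ ]ₐ = []
    (_∷_ {d = d} M a) [ ψ ]ₐ = M [ liftˢ d ψ ] ∷ (a [ ψ ]ₐ)

  mutual
    rename : (Fin n → Fin m) → Term Ψ n → Term Ψ m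
    rename ρ (var x)     = var (ρ x)
    rename ρ (op o rs a) = op o rs (renameₐ ρ a)

    renameₐ : ∀ {bs} → (Fin n → Fin m) → Args Ψ n bs → Args Ψ m bs
    renameₐ ρ []                = []
    renameₐ ρ (_∷_ {t = t} M a) = rename (lift t ρ) M ∷ renameₐ ρ a

  liftᵗ : ∀ d t → Vec (Term Ψ m) n → Vec (Term (d + Ψ) (t + m)) (t + n)
  liftᵗ {m = m} d t σ =
    tabulate (λ x → var (x ↑ˡ m)) Vec.++ Vec.map (λ N → rename (t ↑ʳ_) (N [ πs d ])) σ

  infixl 8 _⟦_⟧ _⟦_⟧ₐ
  mutual
    _⟦_⟧ : Term Ψ n → Vec (Term Ψ m) n → Term Ψ m
    var x     ⟦ σ ⟧ = lookup σ x
    op o rs a ⟦ σ ⟧ = op o rs (a ⟦ σ ⟧ₐ)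

    _⟦_⟧ₐ : ∀ {bs} → Args Ψ n bs → Vec (Term Ψ m) n → Args Ψ m bs
    []                        ⟦ σ ⟧ₐ = []
    (_∷_ {d = d} {t = t} M a) ⟦ σ ⟧ₐ = M ⟦ liftᵗ d t σ ⟧ ∷ (a ⟦ σ ⟧ₐ)

  Closed : ℕ → Set
  Closed Ψ = Term Ψ 0

  infixl 8 _[_]⃗
  _[_]⃗ : Vec (Term Ψ n) k → Sub Ψ′ Ψ → Vec (Term Ψ′ n) k
  Is [ ψ ]⃗ = Vec.map (_[ ψ ]) Is

  dimBinders : ∀ {bs} → Vec (Term (suc Ψ) n) k → Args Ψ n bs →
               Args Ψ n (List.replicate k (1 , 0) List.++ bs)
  dimBinders []       a = a
  dimBinders (N ∷ Ns) a = N ∷ dimBinders Ns a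

  -- hcom A r r′ M ξs Ns is hcom_A^{r ⇝ r′}(M; ξᵢ ↪ y.Nᵢ)
  hcom : Term Ψ n → (r r′ : Dim Ψ) → Term Ψ n →
         Vec (Constraint Ψ) k → Vec (Term (suc Ψ) n) k → Term Ψ n
  hcom {k = k} A r r′ M ξs Ns =
    op (hcomᵒ k)
       (r ∷ r′ ∷ Vec.concat (Vec.map (λ (s , s′) → s ∷ s′ ∷ []) ξs))
       (dimBinders Ns (A ∷ M ∷ []))

  -- coe A r r′ M is coe_{y.A}^{r ⇝ r′}(M)
  coe : Term (suc Ψ) n → (r r′ : Dim Ψ) → Term Ψ n → Term Ψ n
  coe A r r′ M = op coeᵒ (r ∷ r′ ∷ []) (A ∷ M ∷ [])

  -- fcoe I r r′ M is fcoe_{z.I}^{r ⇝ r′}(M)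
  fcoe : Vec (Term (suc Ψ) n) k → (r r′ : Dim Ψ) → Term Ψ n → Term Ψ n
  fcoe {k = k} I r r′ M = op (fcoeᵒ k) (r ∷ r′ ∷ []) (dimBinders I (M ∷ []))

  infixl 5 _▹_
  data Telescope (Ψ : ℕ) : ℕ → Set where
    ∅   : Telescope Ψ 0
    _▹_ : Telescope Ψ n → Term Ψ n → Telescope Ψ (suc n)

  infixl 8 _[_]ᵗ
  _[_]ᵗ : Telescope Ψ n → Sub Ψ′ Ψ → Telescope Ψ′ n
  ∅       [ ψ ]ᵗ = ∅
  (Δ ▹ A) [ ψ ]ᵗ = Δ [ ψ ]ᵗ ▹ A [ ψ ]

-- Emptiness of a list of indices is expressed through its length k.
record OperationalSemantics (S : Signature) : Set₁ where
  open Syntax S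
  infix 4 _↦_
  field
    Val           : Closed Ψ → Set
    _↦_           : Closed Ψ → Closed Ψ → Set
    deterministic : {M N N′ : Closed Ψ} → M ↦ N → M ↦ N′ → N ≡ N′
    val-↦̸         : {M N : Closed Ψ} → Val M → ¬ (M ↦ N)
    fcoe-≡        : {I : Vec (Term (suc Ψ) 0) k} {r r′ : Dim Ψ} {M : Closed Ψ} →
                    r ≡ r′ → fcoe I r r′ M ↦ M
    fcoe-∅        : {I : Vec (Term (suc Ψ) 0) k} {r r′ : Dim Ψ} {M : Closed Ψ} →
                    k ≡ 0 → fcoe I r r′ M ↦ M
    fcoe-val      : {I : Vec (Term (suc Ψ) 0) k} {r r′ : Dim Ψ} {M : Closed Ψ} →
                    r ≢ r′ → k ≢ 0 → Val (fcoe I r r′ M)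

  infix 4 _⇓_
  _⇓_ : Closed Ψ → Closed Ψ → Set
  M ⇓ V = Star _↦_ M V × Val V

module Relations {S : Signature} (O : OperationalSemantics S) where
  open Syntax S
  open OperationalSemantics O

  private variable
    ℓ ℓ₁ ℓ₂ : Level

  OnlyValues : Rel (Closed Ψ) ℓ → Set ℓ
  OnlyValues R = ∀ {M M′} → R M M′ → Val M × Val M′

  ΨRel : (ℓ : Level) → ℕ → Set (lsuc ℓ)
  ΨRel ℓ Ψ = ∀ {Ψ′} → Sub Ψ′ Ψ → Rel (Closed Ψ′) ℓ

  IsValueRel : ΨRel ℓ Ψ → Set ℓ
  IsValueRel {Ψ = Ψ} α = ∀ {Ψ′} (ψ : Sub Ψ′ Ψ) → OnlyValues (α ψ)

  IsΨPER : ΨRel ℓ Ψ → Set ℓ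
  IsΨPER {Ψ = Ψ} α = ∀ {Ψ′} (ψ : Sub Ψ′ Ψ) → IsPartialEquivalence (α ψ)

  -- Equality of relations is having the same extension.
  infix 4 _≋_
  _≋_ : ΨRel ℓ₁ Ψ → ΨRel ℓ₂ Ψ → Set (ℓ₁ ⊔ ℓ₂)
  _≋_ {Ψ = Ψ} α β = ∀ {Ψ′} (ψ : Sub Ψ′ Ψ) → α ψ ⇔ β ψ

  infixl 8 _[_]ʳ
  _[_]ʳ : ΨRel ℓ Ψ → Sub Ψ′ Ψ → ΨRel ℓ Ψ′
  (α [ ψ ]ʳ) ψ′ = α (ψ ∙ ψ′)

  -- Among R Ms is R{M₁,…,Mₙ}
  Among : Rel (Closed Ψ) ℓ → List (Closed Ψ) → Set ℓ
  Among R Ms = ∀ {M M′} → M ∈ˡ Ms → M′ ∈ˡ Ms → R M M′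

  -- Under α ψ Ξ is α_{ψ ∣ Ξ}
  Under : ΨRel ℓ Ψ → Sub Ψ′ Ψ → Vec (Constraint Ψ′) k → Rel (Closed Ψ′) ℓ
  Under {Ψ′ = Ψ′} α ψ Ξ M M′ =
    ∀ {Ψ″} (ψ′ : Sub Ψ″ Ψ′) → ⊨ Vec.map (_[ ψ′ ]ᶜ) Ξ → α (ψ ∙ ψ′) (M [ ψ′ ]) (M′ [ ψ′ ])

  record Evaluations (M : Closed Ψ) {Ψ₁ Ψ₂ : ℕ} (ψ₁ : Sub Ψ₁ Ψ) (ψ₂ : Sub Ψ₂ Ψ₁) : Set where
    field
      M₁   : Closed Ψ₁
      M₂   : Closed Ψ₂
      M₁₂  : Closed Ψ₂
      ⇓M₁  : M [ ψ₁ ] ⇓ M₁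
      ⇓M₂  : M₁ [ ψ₂ ] ⇓ M₂
      ⇓M₁₂ : M [ ψ₁ ] [ ψ₂ ] ⇓ M₁₂

  record CoherentAt (R : ∀ {Ψ} → Sub Ψ Ψ′ → Rel (Closed Ψ) ℓ) (M M′ : Closed Ψ′)
                    {Ψ₁ Ψ₂ : ℕ} (ψ₁ : Sub Ψ₁ Ψ′) (ψ₂ : Sub Ψ₂ Ψ₁) : Set ℓ where
    field
      eval  : Evaluations M ψ₁ ψ₂
      eval′ : Evaluations M′ ψ₁ ψ₂
    open Evaluations eval public
    open Evaluations eval′ public
      renaming (M₁ to M₁′; M₂ to M₂′; M₁₂ to M₁₂′; ⇓M₁ to ⇓M₁′; ⇓M₂ to ⇓M₂′; ⇓M₁₂ to ⇓M₁₂′)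
    χ : Sub Ψ₂ Ψ′
    χ = ψ₁ ∙ ψ₂
    field
      across : R χ M₂ M₂′
      left   : Among (R χ) (M₂ ∷ M₁₂ ∷ [])
      right  : Among (R χ) (M₂′ ∷ M₁₂′ ∷ [])

  Tm : ΨRel ℓ Ψ → ΨRel ℓ Ψ
  Tm α {Ψ′} ψ M M′ =
    ∀ {Ψ₁ Ψ₂} (ψ₁ : Sub Ψ₁ Ψ′) (ψ₂ : Sub Ψ₂ Ψ₁) → CoherentAt (α [ ψ ]ʳ) M M′ ψ₁ ψ₂

  ValueCoherent : ΨRel ℓ Ψ → Set ℓ
  ValueCoherent {Ψ = Ψ} α = ∀ {Ψ′} (ψ : Sub Ψ′ Ψ) {V V′} → α ψ V V′ → Tm α ψ V V′

  Candidate : (ℓ ℓ′ : Level) → Set (lsuc (ℓ ⊔ ℓ′))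
  Candidate ℓ ℓ′ = ∀ Ψ → Closed Ψ → Closed Ψ → Rel (Closed Ψ) ℓ → Set ℓ′

  PTy : Candidate ℓ₁ ℓ₂ → ∀ Ψ → Closed Ψ → Closed Ψ → ΨRel ℓ₁ Ψ → Set ℓ₂
  PTy τ Ψ A A′ α =
    ∀ {Ψ₁ Ψ₂} (ψ₁ : Sub Ψ₁ Ψ) (ψ₂ : Sub Ψ₂ Ψ₁) →
    CoherentAt (λ {Ψ′} ψ B B′ → τ Ψ′ B B′ (α ψ)) A A′ ψ₁ ψ₂

  -- τ-resp has no counterpart on paper, where relations with the same extension
  -- are equal.
  record CubicalTypeSystem (ℓ ℓ′ : Level) : Set (lsuc (ℓ ⊔ ℓ′)) where
    field
      τ        : Candidate ℓ ℓ′
      τ-values : ∀ {A A′ : Closed Ψ} {φ} → τ Ψ A A′ φ → Val A × Val A′ × OnlyValues φ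
      τ-resp   : ∀ {A A′ : Closed Ψ} {φ φ′} → φ ⇔ φ′ → τ Ψ A A′ φ → τ Ψ A A′ φ′
      τ-unique : ∀ {A A′ : Closed Ψ} {φ φ′} → τ Ψ A A′ φ → τ Ψ A A′ φ′ → φ ⇔ φ′
      φ-per    : ∀ {A A′ : Closed Ψ} {φ} → τ Ψ A A′ φ → IsPartialEquivalence φ
      τ-per    : ∀ {φ : Rel (Closed Ψ) ℓ} → IsPartialEquivalence (λ A A′ → τ Ψ A A′ φ)
      τ-PTy    : ∀ {A A′ : Closed Ψ} {φ} → τ Ψ A A′ φ →
                 ∃ λ (α : ΨRel ℓ Ψ) → IsValueRel α × PTy τ Ψ A A′ α

module Judgments {S : Signature} {O : OperationalSemantics S} {ℓ ℓ′ : Level}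
                 (T : Relations.CubicalTypeSystem O ℓ ℓ′) where
  open Syntax S
  open OperationalSemantics O
  open Relations O
  open CubicalTypeSystem T

  -- α is ⟦A⟧ (and ⟦A′⟧); it is unique up to ≋ since τ is a cubical type system.
  record Denotes (A A′ : Closed Ψ) (α : ΨRel ℓ Ψ) : Set (ℓ ⊔ ℓ′) where
    field
      isValueRel    : IsValueRel α
      pty           : PTy τ Ψ A A′ α
      valueCoherent : ValueCoherent α

  infix 4 _≐_type-pre _≐_∶_
  _≐_type-pre : Closed Ψ → Closed Ψ → Set (lsuc ℓ ⊔ ℓ′)
  _≐_type-pre {Ψ = Ψ} A A′ = ∃ λ (α : ΨRel ℓ Ψ) → Denotes A A′ α

  _≐_∶_ : Closed Ψ → Closed Ψ → Closed Ψ → Set (lsuc ℓ ⊔ ℓ′)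
  _≐_∶_ {Ψ = Ψ} M M′ A = ∃ λ (α : ΨRel ℓ Ψ) → Denotes A A α × Tm α idˢ M M′

  record IsKan (A A′ : Closed Ψ) (α : ΨRel ℓ Ψ) : Set ℓ where
    field
      hcom-kan :
        ∀ {Ψ′ k} (ψ : Sub Ψ′ Ψ) (r r′ : Dim Ψ′) (ξ : Vec (Constraint Ψ′) k) →
        Valid ξ →
        (M M′ : Closed Ψ′) (N N′ : Vec (Closed (suc Ψ′)) k) →
        Tm α ψ M M′ →
        (∀ i j → Under (Tm α) (ψ ∙ π) (lookup ξ i [ π ]ᶜ ∷ lookup ξ j [ π ]ᶜ ∷ [])
                   (lookup N i) (lookup N′ j)) →
        (∀ i → Under (Tm α) ψ (lookup ξ i ∷ []) (lookup N i [ ⟨ r /y⟩ ]) M) →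
        let H = λ s → hcom (A [ ψ ]) r s M ξ N in
          Tm α ψ (H r′) (hcom (A′ [ ψ ]) r r′ M′ ξ N′)
        × Tm α ψ (H r) M
        × (∀ i → Under (Tm α) ψ (lookup ξ i ∷ []) (H r′) (lookup N i [ ⟨ r′ /y⟩ ]))
      coe-kan :
        ∀ {Ψ′} (ψ : Sub (suc Ψ′) Ψ) (r r′ : Dim Ψ′) (M M′ : Closed Ψ′) →
        Tm α (ψ ∙ ⟨ r /y⟩) M M′ →
          Tm α (ψ ∙ ⟨ r′ /y⟩) (coe (A [ ψ ]) r r′ M) (coe (A′ [ ψ ]) r r′ M′)
        × Tm α (ψ ∙ ⟨ r /y⟩) (coe (A [ ψ ]) r r M) M

  infix 4 _≐_type-Kan
  _≐_type-Kan : Closed Ψ → Closed Ψ → Set (lsuc ℓ ⊔ ℓ′)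
  _≐_type-Kan {Ψ = Ψ} A A′ = ∃ λ (α : ΨRel ℓ Ψ) → Denotes A A′ α × IsKan A A′ α

  -- Lists are written with the entry for the last type of the telescope first.
  infix 4 _≐_∶⃗_
  data _≐_∶⃗_ : Vec (Closed Ψ) n → Vec (Closed Ψ) n → Telescope Ψ n → Set (lsuc ℓ ⊔ ℓ′) where
    []  : [] ≐ [] ∶⃗ (∅ {Ψ})
    _∷_ : {I I′ : Vec (Closed Ψ) n} {Δ : Telescope Ψ n} {A : Term Ψ n} {M M′ : Closed Ψ} →
          M ≐ M′ ∶ A ⟦ I ⟧ → I ≐ I′ ∶⃗ Δ → (M ∷ I) ≐ (M′ ∷ I′) ∶⃗ (Δ ▹ A)

  infix 4 _≫_≐_type-Kan
  _≫_≐_type-Kan : Telescope Ψ n → Term Ψ n → Term Ψ n → Set (lsuc ℓ ⊔ ℓ′)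
  _≫_≐_type-Kan {Ψ = Ψ} {n = n} Δ A A′ =
    ∀ {Ψ′} (ψ : Sub Ψ′ Ψ) {I I′ : Vec (Closed Ψ′) n} → I ≐ I′ ∶⃗ Δ [ ψ ]ᵗ →
    (A [ ψ ] ⟦ I ⟧) ≐ (A′ [ ψ ] ⟦ I′ ⟧) type-Kan

  infix 4 _≐_ctx-Kan
  data _≐_ctx-Kan : Telescope Ψ n → Telescope Ψ n → Set (lsuc ℓ ⊔ ℓ′) where
    ∅   : (∅ {Ψ}) ≐ ∅ ctx-Kan
    _▹_ : {Δ Δ′ : Telescope Ψ n} {A A′ : Term Ψ n} →
          Δ ≐ Δ′ ctx-Kan → Δ ≫ A ≐ A′ type-Kan → (Δ ▹ A) ≐ (Δ′ ▹ A′) ctx-Kan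

  _ctx-Kan : Telescope Ψ n → Set (lsuc ℓ ⊔ ℓ′)
  Δ ctx-Kan = Δ ≐ Δ ctx-Kan

  -- A Δ-indexed Ψ-relation is a Family satisfying IsIndexed Δ. A family is given on
  -- all lists of the right length, but only its components at I ∈ Δψ are subject to
  -- conditions, so the others carry no information.
  Family : (a : Level) → ℕ → ℕ → Set (lsuc a)
  Family a Ψ n = ∀ {Ψ′} → Sub Ψ′ Ψ → Vec (Closed Ψ′) n → ΨRel a Ψ′

  record IsIndexed {a : Level} (Δ : Telescope Ψ n) (α : Family a Ψ n)
                   : Set (a ⊔ lsuc ℓ ⊔ ℓ′) where
    field
      natural  : ∀ {Ψ′ Ψ″} (ψ : Sub Ψ′ Ψ) {I : Vec (Closed Ψ′) n} → I ≐ I ∶⃗ Δ [ ψ ]ᵗ →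
                 (ψ′ : Sub Ψ″ Ψ′) → α ψ I [ ψ′ ]ʳ ≋ α (ψ ∙ ψ′) (I [ ψ′ ]⃗)
      respects : ∀ {Ψ′} (ψ : Sub Ψ′ Ψ) {I I′ : Vec (Closed Ψ′) n} → I ≐ I′ ∶⃗ Δ [ ψ ]ᵗ →
                 α ψ I ≋ α ψ I′

  IsIndexedValueRel : {a : Level} → Telescope Ψ n → Family a Ψ n → Set (a ⊔ lsuc ℓ ⊔ ℓ′)
  IsIndexedValueRel {Ψ = Ψ} {n = n} Δ α =
    ∀ {Ψ′} (ψ : Sub Ψ′ Ψ) {I : Vec (Closed Ψ′) n} → I ≐ I ∶⃗ Δ [ ψ ]ᵗ → IsValueRel (α ψ I)

  IsIndexedPER : {a : Level} → Telescope Ψ n → Family a Ψ n → Set (a ⊔ lsuc ℓ ⊔ ℓ′)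
  IsIndexedPER {Ψ = Ψ} {n = n} Δ α =
    ∀ {Ψ′} (ψ : Sub Ψ′ Ψ) {I : Vec (Closed Ψ′) n} → I ≐ I ∶⃗ Δ [ ψ ]ᵗ → IsΨPER (α ψ I)

  record ValueIndexedPER {a : Level} (Δ : Telescope Ψ n) (α : Family a Ψ n)
                         : Set (a ⊔ lsuc ℓ ⊔ ℓ′) where
    field
      indexed : IsIndexed Δ α
      value   : IsIndexedValueRel Δ α
      per     : IsIndexedPER Δ α

  infixr 6 _∪_
  _∪_ : {a b : Level} → Family a Ψ n → Family b Ψ n → Family (a ⊔ b) Ψ n
  (α ∪ β) ψ I ψ′ = α ψ I ψ′ ∪ᴿ β ψ I ψ′

  data FcoeId {a : Level} (Δ : Telescope Ψ n) (α : Family a Ψ n)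
              (ψ : Sub Ψ′ Ψ) (I : Vec (Closed Ψ′) n)
              : Rel (Closed Ψ′) (a ⊔ lsuc ℓ ⊔ ℓ′) where
    fcoe-rel : {J J′ : Vec (Closed (suc Ψ′)) n} {r r′ : Dim Ψ′} {M M′ : Closed Ψ′} →
               n ≢ 0 → r ≢ r′ →
               J ≐ J′ ∶⃗ Δ [ ψ ∙ π ]ᵗ →
               J [ ⟨ r′ /y⟩ ]⃗ ≐ I ∶⃗ Δ [ ψ ]ᵗ →
               Tm (α ψ (J [ ⟨ r /y⟩ ]⃗)) idˢ M M′ →
               FcoeId Δ α ψ I (fcoe J r r′ M) (fcoe J′ r r′ M′)

  Fcoe : {a : Level} → Telescope Ψ n → Family a Ψ n → Family (a ⊔ lsuc ℓ ⊔ ℓ′) Ψ n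
  Fcoe Δ α ψ I ψ′ = FcoeId Δ α (ψ ∙ ψ′) (I [ ψ′ ]⃗)

{-# OPTIONS --safe #-}

-- Under a substitution χ, either n = 0 or rχ = r′χ, and then fcoe steps to Mχ while the two
-- endpoints of I coincide, so that everything happens in α; or fcoeχ is a value, related to its
-- primed counterpart by Fcoe. The first alternative is stable under further substitution, hence
-- for a pair ψ₁, ψ₂ only three cases arise: fcoe steps already at ψ₁, steps at ψ₁ψ₂ but not at
-- ψ₁, or does not step at ψ₁ψ₂. In the middle case both M₂ and M₁₂ are the value of Mψ₁ψ₂.
module Submission where

open import Defs
open import Level using (Level)
open import Data.Empty using (⊥-elim)
open import Data.Fin.Base using (Fin; zero; _↑ˡ_; _↑ʳ_; lift)
open import Data.Fin.Properties using () renaming (_≟_ to _≟ᶠ_)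
open import Data.List.Base using ([]; _∷_)
open import Data.List.Relation.Unary.Any using (here; there)
open import Data.Nat.Base using (ℕ; zero; suc)
open import Data.Nat.Properties using () renaming (_≟_ to _≟ⁿ_)
open import Data.Product.Base using (_×_; _,_; proj₁; proj₂)
open import Data.Sum.Base as Sum using (_⊎_; inj₁; inj₂; [_,_]′)
open import Data.Vec.Base as Vec using (Vec; []; _∷_; lookup; tabulate)
open import Data.Vec.Properties
  using (lookup-map; lookup∘tabulate; map-∘; map-cong; map-id; map-++; tabulate-∘; tabulate∘lookup)
open import Data.Vec.Relation.Unary.All using ([]; _∷_)
open import Function.Base using (_∘_; id)
open import Relation.Binary.Construct.Closure.ReflexiveTransitive using (Star; ε; _◅_)
open import Relation.Binary.Core using (Rel; _⇒_; _⇔_)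
open import Relation.Binary.Definitions using (DecidableEquality; Symmetric)
open import Relation.Binary.PropositionalEquality
  using (_≡_; refl; sym; trans; cong; cong₂; subst; subst₂; module ≡-Reasoning)
open import Relation.Binary.Structures using (IsPartialEquivalence)
open import Relation.Nullary using (¬_; Dec; yes; no)
open import Relation.Nullary.Decidable using (map′; _⊎-dec_)

private variable
  Ψ Ψ′ Ψ″ Ψ₁ Ψ₂ Φ : ℕ
  k m n : ℕ

-- Dimension terms and the algebra of dimension substitutions.

infix 4 _≟_
_≟_ : DecidableEquality (Dim Ψ)
𝟎     ≟ 𝟎     = yes refl
𝟎     ≟ 𝟏     = no λ ()
𝟎     ≟ var _ = no λ ()
𝟏     ≟ 𝟎     = no λ ()
𝟏     ≟ 𝟏     = yes refl
𝟏     ≟ var _ = no λ ()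
var _ ≟ 𝟎     = no λ ()
var _ ≟ 𝟏     = no λ ()
var x ≟ var y = map′ (cong var) (λ { refl → refl }) (x ≟ᶠ y)

[]ᵈ-∙ : (r : Dim Ψ) (ψ : Sub Ψ′ Ψ) (ψ′ : Sub Ψ″ Ψ′) → r [ ψ ]ᵈ [ ψ′ ]ᵈ ≡ r [ ψ ∙ ψ′ ]ᵈ
[]ᵈ-∙ 𝟎       ψ ψ′ = refl
[]ᵈ-∙ 𝟏       ψ ψ′ = refl
[]ᵈ-∙ (var x) ψ ψ′ = sym (lookup-map x _ ψ)

∙-assoc : (ψ : Sub Ψ′ Ψ) (ψ′ : Sub Ψ″ Ψ′) (χ : Sub Φ Ψ″) → (ψ ∙ ψ′) ∙ χ ≡ ψ ∙ (ψ′ ∙ χ)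
∙-assoc ψ ψ′ χ = trans (sym (map-∘ _ _ ψ)) (map-cong (λ r → []ᵈ-∙ r ψ′ χ) ψ)

∙-identityˡ : (ψ : Sub Ψ′ Ψ) → idˢ ∙ ψ ≡ ψ
∙-identityˡ ψ = trans (sym (tabulate-∘ _ _)) (tabulate∘lookup ψ)

[]ᵈ-id : (r : Dim Ψ) → r [ idˢ ]ᵈ ≡ r
[]ᵈ-id 𝟎       = refl
[]ᵈ-id 𝟏       = refl
[]ᵈ-id (var x) = lookup∘tabulate var x

∙-identityʳ : (ψ : Sub Ψ′ Ψ) → ψ ∙ idˢ ≡ ψ
∙-identityʳ ψ = trans (map-cong []ᵈ-id ψ) (map-id ψ)

π-∙-∷ : (r : Dim Ψ′) (ψ : Sub Ψ′ Ψ) → π ∙ (r ∷ ψ) ≡ ψ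
π-∙-∷ r ψ = trans (sym (tabulate-∘ _ _)) (tabulate∘lookup ψ)

liftˢ-∙ : ∀ d (ψ : Sub Ψ′ Ψ) (ψ′ : Sub Ψ″ Ψ′) → liftˢ d ψ ∙ liftˢ d ψ′ ≡ liftˢ d (ψ ∙ ψ′)
liftˢ-∙ zero    ψ ψ′ = refl
liftˢ-∙ (suc d) ψ ψ′ = cong (var zero ∷_) (begin
  (liftˢ d ψ ∙ π) ∙ liftˢ (suc d) ψ′   ≡⟨ ∙-assoc (liftˢ d ψ) π _ ⟩
  liftˢ d ψ ∙ (π ∙ liftˢ (suc d) ψ′)   ≡⟨ cong (liftˢ d ψ ∙_) (π-∙-∷ _ _) ⟩
  liftˢ d ψ ∙ (liftˢ d ψ′ ∙ π)         ≡⟨ ∙-assoc (liftˢ d ψ) _ π ⟨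
  (liftˢ d ψ ∙ liftˢ d ψ′) ∙ π         ≡⟨ cong (_∙ π) (liftˢ-∙ d ψ ψ′) ⟩
  liftˢ d (ψ ∙ ψ′) ∙ π                 ∎)
  where open ≡-Reasoning

-- Naturality of weakening: `liftᵗ` weakens by `πs d` when it goes under a binder, and this lets a
-- dimension substitution pass through it.
πs-∙-liftˢ : ∀ d (ψ : Sub Ψ′ Ψ) → πs d ∙ liftˢ d ψ ≡ ψ ∙ πs d
πs-∙-liftˢ zero    ψ = trans (∙-identityˡ ψ) (sym (∙-identityʳ ψ))
πs-∙-liftˢ (suc d) ψ = begin
  (πs d ∙ π) ∙ liftˢ (suc d) ψ   ≡⟨ ∙-assoc (πs d) π _ ⟩
  πs d ∙ (π ∙ liftˢ (suc d) ψ)   ≡⟨ cong (πs d ∙_) (π-∙-∷ _ _) ⟩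
  πs d ∙ (liftˢ d ψ ∙ π)         ≡⟨ ∙-assoc (πs d) _ π ⟨
  (πs d ∙ liftˢ d ψ) ∙ π         ≡⟨ cong (_∙ π) (πs-∙-liftˢ d ψ) ⟩
  (ψ ∙ πs d) ∙ π                 ≡⟨ ∙-assoc ψ (πs d) π ⟩
  ψ ∙ (πs d ∙ π)                 ∎
  where open ≡-Reasoning

∙-π-∙-⟨/y⟩ : (ψ : Sub Ψ′ Ψ) (r : Dim Ψ′) → (ψ ∙ π) ∙ ⟨ r /y⟩ ≡ ψ
∙-π-∙-⟨/y⟩ ψ r =
  trans (∙-assoc ψ π _) (trans (cong (ψ ∙_) (π-∙-∷ r idˢ)) (∙-identityʳ ψ))

-- Both sides send `y` to `r [ ψ ]ᵈ` and act as `ψ` on the other variables. This moves an endpoint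
-- of a line of indices across a substitution.
⟨/y⟩-∙ : (r : Dim Ψ) (ψ : Sub Ψ′ Ψ) → ⟨ r /y⟩ ∙ ψ ≡ liftˢ 1 ψ ∙ ⟨ r [ ψ ]ᵈ /y⟩
⟨/y⟩-∙ r ψ = cong (r [ ψ ]ᵈ ∷_) (trans (∙-identityˡ ψ) (sym (∙-π-∙-⟨/y⟩ ψ _)))

-- Collects the side conditions of `fcoe-∅` and `fcoe-≡`; a refutation supplies both premises of
-- `fcoe-val`.
Degenerate : ℕ → Dim Ψ → Dim Ψ → Set
Degenerate n r r′ = n ≡ 0 ⊎ r ≡ r′

degenerate? : ∀ n (r r′ : Dim Ψ) → Dec (Degenerate n r r′)
degenerate? n r r′ = (n ≟ⁿ 0) ⊎-dec (r ≟ r′)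

-- The length `n` is fixed by substitution and equal dimension terms stay equal. The converse fails,
-- because a substitution may identify distinct terms; hence the middle case in `fcoe-cong`.
degenerate-∙ : (r r′ : Dim Ψ) (ψ : Sub Ψ′ Ψ) (ψ′ : Sub Ψ″ Ψ′) →
               Degenerate n (r [ ψ ]ᵈ) (r′ [ ψ ]ᵈ) →
               Degenerate n (r [ ψ ∙ ψ′ ]ᵈ) (r′ [ ψ ∙ ψ′ ]ᵈ)
degenerate-∙ r r′ ψ ψ′ =
  Sum.map₂ λ eq → trans (sym ([]ᵈ-∙ r ψ ψ′)) (trans (cong (_[ ψ′ ]ᵈ) eq) ([]ᵈ-∙ r′ ψ ψ′))

-- Commutation of dimension substitution with the operations on terms.

module Substitution (S : Signature) where
  open Syntax S

  mutual
    []-∙ : (M : Term Ψ n) (ψ : Sub Ψ′ Ψ) (ψ′ : Sub Ψ″ Ψ′) → M [ ψ ] [ ψ′ ] ≡ M [ ψ ∙ ψ′ ]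
    []-∙ (var x)     ψ ψ′ = refl
    []-∙ (op o rs a) ψ ψ′ = cong₂ (op o) (∙-assoc rs ψ ψ′) ([]ₐ-∙ a ψ ψ′)

    []ₐ-∙ : ∀ {bs} (a : Args Ψ n bs) (ψ : Sub Ψ′ Ψ) (ψ′ : Sub Ψ″ Ψ′) →
            a [ ψ ]ₐ [ ψ′ ]ₐ ≡ a [ ψ ∙ ψ′ ]ₐ
    []ₐ-∙ []                ψ ψ′ = refl
    []ₐ-∙ (_∷_ {d = d} M a) ψ ψ′ =
      cong₂ _∷_ (trans ([]-∙ M _ _) (cong (M [_]) (liftˢ-∙ d ψ ψ′))) ([]ₐ-∙ a ψ ψ′)

  mutual
    rename-[] : (ρ : Fin n → Fin m) (M : Term Ψ n) (ψ : Sub Ψ′ Ψ) →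
                rename ρ M [ ψ ] ≡ rename ρ (M [ ψ ])
    rename-[] ρ (var x)     ψ = refl
    rename-[] ρ (op o rs a) ψ = cong (op o (rs ∙ ψ)) (renameₐ-[] ρ a ψ)

    renameₐ-[] : ∀ {bs} (ρ : Fin n → Fin m) (a : Args Ψ n bs) (ψ : Sub Ψ′ Ψ) →
                 renameₐ ρ a [ ψ ]ₐ ≡ renameₐ ρ (a [ ψ ]ₐ)
    renameₐ-[] ρ []                        ψ = refl
    renameₐ-[] ρ (_∷_ {d = d} {t = t} M a) ψ =
      cong₂ _∷_ (rename-[] (lift t ρ) M (liftˢ d ψ)) (renameₐ-[] ρ a ψ)

  -- Term variables contain no dimensions, so only the weakened entries of `σ` change; for these,
  -- `weaken-[]` reduces the claim to naturality of `πs`.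
  liftᵗ-[] : ∀ d t (σ : Vec (Term Ψ m) n) (ψ : Sub Ψ′ Ψ) →
             liftᵗ d t σ [ liftˢ d ψ ]⃗ ≡ liftᵗ d t (σ [ ψ ]⃗)
  liftᵗ-[] {m = m} d t σ ψ =
    trans (map-++ _ (tabulate λ x → var (x ↑ˡ m)) _)
          (cong₂ Vec._++_ (sym (tabulate-∘ _ _))
            (trans (sym (map-∘ _ _ σ)) (trans (map-cong weaken-[] σ) (map-∘ _ _ σ))))
    where
    open ≡-Reasoning
    weaken-[] : ∀ N → rename (t ↑ʳ_) (N [ πs d ]) [ liftˢ d ψ ] ≡
                      rename (t ↑ʳ_) (N [ ψ ] [ πs d ])
    weaken-[] N = begin
      rename (t ↑ʳ_) (N [ πs d ]) [ liftˢ d ψ ]   ≡⟨ rename-[] _ (N [ πs d ]) _ ⟩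
      rename (t ↑ʳ_) (N [ πs d ] [ liftˢ d ψ ])   ≡⟨ cong (rename _) ([]-∙ N _ _) ⟩
      rename (t ↑ʳ_) (N [ πs d ∙ liftˢ d ψ ])     ≡⟨ cong (λ φ → rename _ (N [ φ ])) (πs-∙-liftˢ d ψ) ⟩
      rename (t ↑ʳ_) (N [ ψ ∙ πs d ])             ≡⟨ cong (rename _) ([]-∙ N _ _) ⟨
      rename (t ↑ʳ_) (N [ ψ ] [ πs d ])           ∎

  mutual
    -- Entries of an index list are typed by instances `A ⟦ I ⟧`, so stability of list equality
    -- under dimension substitution rests on this.
    ⟦⟧-[] : (M : Term Ψ n) (σ : Vec (Term Ψ m) n) (ψ : Sub Ψ′ Ψ) →
            M ⟦ σ ⟧ [ ψ ] ≡ M [ ψ ] ⟦ σ [ ψ ]⃗ ⟧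
    ⟦⟧-[] (var x)     σ ψ = sym (lookup-map x _ σ)
    ⟦⟧-[] (op o rs a) σ ψ = cong (op o (rs ∙ ψ)) (⟦⟧ₐ-[] a σ ψ)

    ⟦⟧ₐ-[] : ∀ {bs} (a : Args Ψ n bs) (σ : Vec (Term Ψ m) n) (ψ : Sub Ψ′ Ψ) →
             a ⟦ σ ⟧ₐ [ ψ ]ₐ ≡ a [ ψ ]ₐ ⟦ σ [ ψ ]⃗ ⟧ₐ
    ⟦⟧ₐ-[] []                        σ ψ = refl
    ⟦⟧ₐ-[] (_∷_ {d = d} {t = t} M a) σ ψ =
      cong₂ _∷_ (trans (⟦⟧-[] M _ _) (cong (M [ liftˢ d ψ ] ⟦_⟧) (liftᵗ-[] d t σ ψ)))
                (⟦⟧ₐ-[] a σ ψ)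

  []⃗-∙ : (I : Vec (Term Ψ n) k) (ψ : Sub Ψ′ Ψ) (ψ′ : Sub Ψ″ Ψ′) →
         I [ ψ ]⃗ [ ψ′ ]⃗ ≡ I [ ψ ∙ ψ′ ]⃗
  []⃗-∙ I ψ ψ′ = trans (sym (map-∘ _ _ I)) (map-cong (λ M → []-∙ M ψ ψ′) I)

  []ᵗ-∙ : (Δ : Telescope Ψ n) (ψ : Sub Ψ′ Ψ) (ψ′ : Sub Ψ″ Ψ′) →
          Δ [ ψ ]ᵗ [ ψ′ ]ᵗ ≡ Δ [ ψ ∙ ψ′ ]ᵗ
  []ᵗ-∙ ∅       ψ ψ′ = refl
  []ᵗ-∙ (Δ ▹ A) ψ ψ′ = cong₂ _▹_ ([]ᵗ-∙ Δ ψ ψ′) ([]-∙ A ψ ψ′)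

  ⟨/y⟩-[] : (I : Vec (Term (suc Ψ) n) k) (r : Dim Ψ) (ψ : Sub Ψ′ Ψ) →
            I [ ⟨ r /y⟩ ]⃗ [ ψ ]⃗ ≡ I [ liftˢ 1 ψ ]⃗ [ ⟨ r [ ψ ]ᵈ /y⟩ ]⃗
  ⟨/y⟩-[] I r ψ =
    trans ([]⃗-∙ I _ _) (trans (cong (I [_]⃗) (⟨/y⟩-∙ r ψ)) (sym ([]⃗-∙ I _ _)))

  degenerate-endpoints : (I : Vec (Term (suc Ψ) n) k) {r r′ : Dim Ψ} → Degenerate k r r′ →
                         I [ ⟨ r /y⟩ ]⃗ ≡ I [ ⟨ r′ /y⟩ ]⃗
  degenerate-endpoints I  (inj₂ refl) = refl
  degenerate-endpoints [] (inj₁ refl) = refl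

  dimBinders-[] : ∀ {bs} (I : Vec (Term (suc Ψ) n) k) (a : Args Ψ n bs) (ψ : Sub Ψ′ Ψ) →
                  dimBinders I a [ ψ ]ₐ ≡ dimBinders (I [ liftˢ 1 ψ ]⃗) (a [ ψ ]ₐ)
  dimBinders-[] []      a ψ = refl
  dimBinders-[] (N ∷ I) a ψ = cong (N [ liftˢ 1 ψ ] ∷_) (dimBinders-[] I a ψ)

  fcoe-[] : (I : Vec (Term (suc Ψ) n) k) (r r′ : Dim Ψ) (M : Term Ψ n) (ψ : Sub Ψ′ Ψ) →
            fcoe I r r′ M [ ψ ] ≡ fcoe (I [ liftˢ 1 ψ ]⃗) (r [ ψ ]ᵈ) (r′ [ ψ ]ᵈ) (M [ ψ ])
  fcoe-[] I r r′ M ψ = cong (op _ _) (dimBinders-[] I (M ∷ []) ψ)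

-- Evaluation, head expansion and closure properties of `Tm`.

module Coherence {S : Signature} (O : OperationalSemantics S) where
  open Syntax S
  open Substitution S
  open OperationalSemantics O
  open Relations O

  private variable
    ℓ ℓ₁ ℓ₂ : Level

  -- Values do not step, so two runs from one term cannot stop at different points.
  ⇓-deterministic : {M V V′ : Closed Ψ} → M ⇓ V → M ⇓ V′ → V ≡ V′
  ⇓-deterministic (ss , v) (ts , v′) = go ss ts v v′
    where
    go : ∀ {M V V′} → Star _↦_ M V → Star _↦_ M V′ → Val V → Val V′ → V ≡ V′
    go ε        ε        v v′ = refl
    go ε        (t ◅ _)  v v′ = ⊥-elim (val-↦̸ v t)
    go (s ◅ _)  ε        v v′ = ⊥-elim (val-↦̸ v′ s)
    go (s ◅ ss) (t ◅ ts) v v′ with refl ← deterministic s t = go ss ts v v′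

  infix 4 _⊑_ _≼_
  _⊑_ : Closed Ψ → Closed Ψ → Set
  M ⊑ N = ∀ {V} → M ⇓ V → N ⇓ V

  ⊑-reflexive : {M N : Closed Ψ} → M ≡ N → M ⊑ N
  ⊑-reflexive refl = id

  ↦⇒⊑ : {M N : Closed Ψ} → N ↦ M → M ⊑ N
  ↦⇒⊑ s (ss , v) = s ◅ ss , v

  -- Evaluation need not commute with dimension substitution, while `Tm` inspects every instance of
  -- a term; hence the comparison at all `ψ`.
  _≼_ : Closed Ψ → Closed Ψ → Set
  _≼_ {Ψ} M N = ∀ {Ψ′} (ψ : Sub Ψ′ Ψ) → M [ ψ ] ⊑ N [ ψ ]

  ⊑-[]-∙ : (M N : Closed Ψ) (ψ : Sub Ψ′ Ψ) (ψ′ : Sub Ψ″ Ψ′) →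
           M [ ψ ∙ ψ′ ] ⊑ N [ ψ ∙ ψ′ ] → M [ ψ ] [ ψ′ ] ⊑ N [ ψ ] [ ψ′ ]
  ⊑-[]-∙ M N ψ ψ′ = subst₂ _⊑_ (sym ([]-∙ M ψ ψ′)) (sym ([]-∙ N ψ ψ′))

  -- R and R′ may live over different dimension contexts, so this covers substitution, head
  -- expansion and change of relation at once.
  coherent-map :
    {R : ∀ {Φ} → Sub Φ Ψ → Rel (Closed Φ) ℓ₁} {R′ : ∀ {Φ} → Sub Φ Ψ′ → Rel (Closed Φ) ℓ₂}
    {M M′ : Closed Ψ} {N N′ : Closed Ψ′} {ψ₁ : Sub Ψ₁ Ψ} {φ₁ : Sub Ψ₁ Ψ′} {ψ₂ : Sub Ψ₂ Ψ₁} →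
    R (ψ₁ ∙ ψ₂) ⇒ R′ (φ₁ ∙ ψ₂) →
    M  [ ψ₁ ] ⊑ N  [ φ₁ ] → M  [ ψ₁ ] [ ψ₂ ] ⊑ N  [ φ₁ ] [ ψ₂ ] →
    M′ [ ψ₁ ] ⊑ N′ [ φ₁ ] → M′ [ ψ₁ ] [ ψ₂ ] ⊑ N′ [ φ₁ ] [ ψ₂ ] →
    CoherentAt R M M′ ψ₁ ψ₂ → CoherentAt R′ N N′ φ₁ ψ₂
  coherent-map R⇒R′ M⊑N Mψ₂⊑Nψ₂ M′⊑N′ M′ψ₂⊑N′ψ₂ c = record
    { eval   = record { ⇓M₁ = M⊑N C.⇓M₁   ; ⇓M₂ = C.⇓M₂  ; ⇓M₁₂ = Mψ₂⊑Nψ₂ C.⇓M₁₂ }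
    ; eval′  = record { ⇓M₁ = M′⊑N′ C.⇓M₁′ ; ⇓M₂ = C.⇓M₂′ ; ⇓M₁₂ = M′ψ₂⊑N′ψ₂ C.⇓M₁₂′ }
    ; across = R⇒R′ C.across
    ; left   = λ x y → R⇒R′ (C.left x y)
    ; right  = λ x y → R⇒R′ (C.right x y)
    }
    where module C = CoherentAt c

  module _ {R : ∀ {Φ} → Sub Φ Ψ → Rel (Closed Φ) ℓ} {M M′ : Closed Ψ}
           {ψ₁ : Sub Ψ₁ Ψ} {ψ₂ : Sub Ψ₂ Ψ₁} (c : CoherentAt R M M′ ψ₁ ψ₂) where
    open CoherentAt c

    -- The clause `left` already contains the pair of `M₂` with itself, so reflexivity is read off
    -- rather than derived from a PER.
    coherent-reflˡ : CoherentAt R M M ψ₁ ψ₂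
    coherent-reflˡ = record
      { eval = eval ; eval′ = eval ; across = left (here refl) (here refl) ; left = left ; right = left }

    coherent-reflʳ : CoherentAt R M′ M′ ψ₁ ψ₂
    coherent-reflʳ = record
      { eval = eval′ ; eval′ = eval′ ; across = right (here refl) (here refl) ; left = right ; right = right }

    coherent-sym : Symmetric (R (ψ₁ ∙ ψ₂)) → CoherentAt R M′ M ψ₁ ψ₂
    coherent-sym R-sym = record
      { eval = eval′ ; eval′ = eval ; across = R-sym across ; left = right ; right = left }

    -- Coherence links the two sides only through `M₂` and `M₂′`; the chain `M₁₂`, `M₂`, `M₂′`,
    -- `M₁₂′` carries the link over to direct evaluation.
    across₁₂ : IsPartialEquivalence (R (ψ₁ ∙ ψ₂)) → R (ψ₁ ∙ ψ₂) M₁₂ M₁₂′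
    across₁₂ per = P.trans (left (there (here refl)) (here refl))
                           (P.trans across (right (here refl) (there (here refl))))
      where module P = IsPartialEquivalence per

  -- For the cases in which `M₂` and `M₁₂` are the same value.
  among-const : {R : Rel (Closed Ψ) ℓ} {M : Closed Ψ} → R M M → Among R (M ∷ M ∷ [])
  among-const Rmm (here refl)         (here refl)         = Rmm
  among-const Rmm (here refl)         (there (here refl)) = Rmm
  among-const Rmm (there (here refl)) (here refl)         = Rmm
  among-const Rmm (there (here refl)) (there (here refl)) = Rmm

  -- `M₁` is inherited from `≼` at `ψ₁` and `M₁₂` from `≼` at `ψ₁ ∙ ψ₂`; `M₂` comes from the same
  -- `M₁`, so its evaluation is reused unchanged.
  Tm-map : {α : ΨRel ℓ₁ Ψ} {β : ΨRel ℓ₂ Φ} {ψ : Sub Ψ′ Ψ} {φ : Sub Ψ′ Φ} {M M′ N N′ : Closed Ψ′} →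
           (∀ {Ψ″} (χ : Sub Ψ″ Ψ′) → α (ψ ∙ χ) ⇒ β (φ ∙ χ)) → M ≼ N → M′ ≼ N′ →
           Tm α ψ M M′ → Tm β φ N N′
  Tm-map {α = α} {β} {ψ} {φ} {M} {M′} {N} {N′} α⇒β M≼N M′≼N′ t ψ₁ ψ₂ =
    coherent-map {R = α [ ψ ]ʳ} {R′ = β [ φ ]ʳ} {M = M} {M′} {N} {N′}
      (α⇒β (ψ₁ ∙ ψ₂))
      (M≼N ψ₁) (⊑-[]-∙ M N ψ₁ ψ₂ (M≼N (ψ₁ ∙ ψ₂)))
      (M′≼N′ ψ₁) (⊑-[]-∙ M′ N′ ψ₁ ψ₂ (M′≼N′ (ψ₁ ∙ ψ₂)))
      (t ψ₁ ψ₂)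

  Tm-cong : {α : ΨRel ℓ₁ Ψ} {β : ΨRel ℓ₂ Φ} {ψ : Sub Ψ′ Ψ} {φ : Sub Ψ′ Φ} {M M′ : Closed Ψ′} →
            (∀ {Ψ″} (χ : Sub Ψ″ Ψ′) → α (ψ ∙ χ) ⇒ β (φ ∙ χ)) → Tm α ψ M M′ → Tm β φ M M′
  Tm-cong {α = α} {β} {ψ} {φ} {M} {M′} α⇒β =
    Tm-map {α = α} {β} {ψ} {φ} {M} {M′} {M} {M′} α⇒β (λ _ → id) (λ _ → id)

  -- The pair `ψ₁`, `ψ₂` for a term instantiated by `χ` is the pair `χ ∙ ψ₁`, `ψ₂` for the term
  -- itself. Leaving `R` general serves both `Tm` and `PTy`.
  coherent-[] :
    {R : ∀ {Φ} → Sub Φ Ψ → Rel (Closed Φ) ℓ₁} {R′ : ∀ {Φ} → Sub Φ Ψ′ → Rel (Closed Φ) ℓ₂}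
    (M M′ : Closed Ψ) (χ : Sub Ψ′ Ψ) (ψ₁ : Sub Ψ₁ Ψ′) (ψ₂ : Sub Ψ₂ Ψ₁) →
    R ((χ ∙ ψ₁) ∙ ψ₂) ⇒ R′ (ψ₁ ∙ ψ₂) →
    CoherentAt R M M′ (χ ∙ ψ₁) ψ₂ → CoherentAt R′ (M [ χ ]) (M′ [ χ ]) ψ₁ ψ₂
  coherent-[] {R = R} {R′} M M′ χ ψ₁ ψ₂ R⇒R′ =
    coherent-map {R = R} {R′ = R′} {M = M} {M′} {M [ χ ]} {M′ [ χ ]} R⇒R′
      (⊑-reflexive (sym eq)) (⊑-reflexive (cong (_[ ψ₂ ]) (sym eq)))
      (⊑-reflexive (sym eq′)) (⊑-reflexive (cong (_[ ψ₂ ]) (sym eq′)))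
    where
    eq  = []-∙ M  χ ψ₁
    eq′ = []-∙ M′ χ ψ₁

  Tm-[] : {α : ΨRel ℓ Ψ} {ψ : Sub Ψ′ Ψ} {M M′ : Closed Ψ′} → Tm α ψ M M′ →
          (χ : Sub Ψ″ Ψ′) → Tm α (ψ ∙ χ) (M [ χ ]) (M′ [ χ ])
  Tm-[] {α = α} {ψ} {M} {M′} t χ ψ₁ ψ₂ =
    coherent-[] {R = α [ ψ ]ʳ} {R′ = α [ ψ ∙ χ ]ʳ} M M′ χ ψ₁ ψ₂
      (subst (λ φ → α φ _ _) (trans (cong (ψ ∙_) (∙-assoc χ ψ₁ ψ₂)) (sym (∙-assoc ψ χ _))))
      (t (χ ∙ ψ₁) ψ₂)

  module _ {α : ΨRel ℓ Ψ} {M M′ : Closed Ψ} where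
    private
      change : {R R′ : ∀ {Φ} → Sub Φ Ψ → Rel (Closed Φ) ℓ} (ψ₁ : Sub Ψ₁ Ψ) (ψ₂ : Sub Ψ₂ Ψ₁) →
               R (ψ₁ ∙ ψ₂) ⇒ R′ (ψ₁ ∙ ψ₂) → CoherentAt R M M′ ψ₁ ψ₂ → CoherentAt R′ M M′ ψ₁ ψ₂
      change {R = R} {R′} ψ₁ ψ₂ R⇒R′ =
        coherent-map {R = R} {R′ = R′} {M = M} {M′} {M} {M′} R⇒R′ id id id id

    -- `Tm α idˢ` reads `α` at `idˢ ∙ (ψ₁ ∙ ψ₂)`, which equals `ψ₁ ∙ ψ₂` only propositionally; this
    -- and its converse absorb the identity once and for all.
    coherent⇒Tm-id : (∀ {Ψ₁ Ψ₂} (ψ₁ : Sub Ψ₁ Ψ) (ψ₂ : Sub Ψ₂ Ψ₁) → CoherentAt α M M′ ψ₁ ψ₂) →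
                     Tm α idˢ M M′
    coherent⇒Tm-id c ψ₁ ψ₂ =
      change {R = α} {α [ idˢ ]ʳ} ψ₁ ψ₂ (subst (λ φ → α φ _ _) (sym (∙-identityˡ _))) (c ψ₁ ψ₂)

    Tm-id⇒coherent : Tm α idˢ M M′ →
                     ∀ {Ψ₁ Ψ₂} (ψ₁ : Sub Ψ₁ Ψ) (ψ₂ : Sub Ψ₂ Ψ₁) → CoherentAt α M M′ ψ₁ ψ₂
    Tm-id⇒coherent t ψ₁ ψ₂ =
      change {R = α [ idˢ ]ʳ} {α} ψ₁ ψ₂ (subst (λ φ → α φ _ _) (∙-identityˡ _)) (t ψ₁ ψ₂)

  Tm-reflˡ : {α : ΨRel ℓ Ψ} {ψ : Sub Ψ′ Ψ} {M M′ : Closed Ψ′} → Tm α ψ M M′ → Tm α ψ M M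
  Tm-reflˡ {α = α} {ψ} t ψ₁ ψ₂ = coherent-reflˡ {R = α [ ψ ]ʳ} (t ψ₁ ψ₂)

  Tm-reflʳ : {α : ΨRel ℓ Ψ} {ψ : Sub Ψ′ Ψ} {M M′ : Closed Ψ′} → Tm α ψ M M′ → Tm α ψ M′ M′
  Tm-reflʳ {α = α} {ψ} t ψ₁ ψ₂ = coherent-reflʳ {R = α [ ψ ]ʳ} (t ψ₁ ψ₂)

  Tm-sym : {α : ΨRel ℓ Ψ} {ψ : Sub Ψ′ Ψ} {M M′ : Closed Ψ′} → IsΨPER α →
           Tm α ψ M M′ → Tm α ψ M′ M
  Tm-sym {α = α} {ψ} per t ψ₁ ψ₂ =
    coherent-sym {R = α [ ψ ]ʳ} (t ψ₁ ψ₂) (IsPartialEquivalence.sym (per (ψ ∙ (ψ₁ ∙ ψ₂))))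

  fcoe-degenerate : (I : Vec (Closed (suc Ψ)) n) (r r′ : Dim Ψ) (M : Closed Ψ) (χ : Sub Ψ′ Ψ) →
                    Degenerate n (r [ χ ]ᵈ) (r′ [ χ ]ᵈ) → M [ χ ] ⊑ fcoe I r r′ M [ χ ]
  fcoe-degenerate I r r′ M χ deg =
    subst (M [ χ ] ⊑_) (sym (fcoe-[] I r r′ M χ)) (↦⇒⊑ ([ fcoe-∅ , fcoe-≡ ]′ deg))

  fcoe-nondegenerate : (I : Vec (Closed (suc Ψ)) n) (r r′ : Dim Ψ) (M : Closed Ψ) (χ : Sub Ψ′ Ψ) →
                       ¬ Degenerate n (r [ χ ]ᵈ) (r′ [ χ ]ᵈ) →
                       fcoe I r r′ M [ χ ] ⇓ fcoe I r r′ M [ χ ]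
  fcoe-nondegenerate I r r′ M χ ¬deg =
    ε , subst Val (sym (fcoe-[] I r r′ M χ)) (fcoe-val (¬deg ∘ inj₂) (¬deg ∘ inj₁))

-- Denotations of pretypes and equality of terms and index lists.

module Typing {S : Signature} {O : OperationalSemantics S} {ℓ ℓ′ : Level}
              (T : Relations.CubicalTypeSystem O ℓ ℓ′) where
  open Syntax S
  open Substitution S
  open Relations O
  open Coherence O
  open CubicalTypeSystem T
  open Judgments T
  open OperationalSemantics O using (_⇓_)

  Denotes-reflˡ : {A A′ : Closed Ψ} {α : ΨRel ℓ Ψ} → Denotes A A′ α → Denotes A A α
  Denotes-reflˡ {α = α} D = record
    { isValueRel    = D.isValueRel
    ; pty           = λ ψ₁ ψ₂ → coherent-reflˡ {R = λ φ B B′ → τ _ B B′ (α φ)} (D.pty ψ₁ ψ₂)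
    ; valueCoherent = D.valueCoherent
    }
    where module D = Denotes D

  Denotes-reflʳ : {A A′ : Closed Ψ} {α : ΨRel ℓ Ψ} → Denotes A A′ α → Denotes A′ A′ α
  Denotes-reflʳ {α = α} D = record
    { isValueRel    = D.isValueRel
    ; pty           = λ ψ₁ ψ₂ → coherent-reflʳ {R = λ φ B B′ → τ _ B B′ (α φ)} (D.pty ψ₁ ψ₂)
    ; valueCoherent = D.valueCoherent
    }
    where module D = Denotes D

  -- Instantiating `pty` at `ψ` followed by the identity puts `α ψ` under `τ`, whose relations are
  -- PERs.
  Denotes-PER : {A A′ : Closed Ψ} {α : ΨRel ℓ Ψ} → Denotes A A′ α → IsΨPER α
  Denotes-PER {α = α} D ψ =
    subst (λ φ → IsPartialEquivalence (α φ)) (∙-identityʳ ψ)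
      (φ-per (CoherentAt.across (Denotes.pty D ψ idˢ)))

  -- By determinism both denotations evaluate `A` to the same value. The diagonal clauses `left` are
  -- compared, because `τ-unique` asks for the same pair of types and `A′`, `A″` may differ.
  Denotes-unique : {A A′ A″ : Closed Ψ} {α β : ΨRel ℓ Ψ} →
                   Denotes A A′ α → Denotes A A″ β → α ≋ β
  Denotes-unique {α = α} {β} D E ψ =
    subst (λ φ → α φ ⇔ β φ) (∙-identityʳ ψ)
      (τ-unique (subst (λ B → τ _ B B _) A₂≡ (C.left (here refl) (here refl)))
                (C′.left (here refl) (here refl)))
    where
    module C  = CoherentAt (Denotes.pty D ψ idˢ)
    module C′ = CoherentAt (Denotes.pty E ψ idˢ)
    A₂≡ : C.M₂ ≡ C′.M₂
    A₂≡ = ⇓-deterministic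
      (subst (λ B → B [ idˢ ] ⇓ C.M₂) (⇓-deterministic C.⇓M₁ C′.⇓M₁) C.⇓M₂) C′.⇓M₂

  Denotes-[] : {A A′ : Closed Ψ} {α : ΨRel ℓ Ψ} → Denotes A A′ α → (ψ : Sub Ψ′ Ψ) →
               Denotes (A [ ψ ]) (A′ [ ψ ]) (α [ ψ ]ʳ)
  Denotes-[] {A = A} {A′} {α} D ψ = record
    { isValueRel    = λ φ → D.isValueRel (ψ ∙ φ)
    ; pty           = λ ψ₁ ψ₂ →
        coherent-[] {R = λ φ B B′ → τ _ B B′ (α φ)} {R′ = λ φ B B′ → τ _ B B′ (α (ψ ∙ φ))}
          A A′ ψ ψ₁ ψ₂ (subst (λ φ → τ _ _ _ (α φ)) (∙-assoc ψ ψ₁ ψ₂)) (D.pty (ψ ∙ ψ₁) ψ₂)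
    ; valueCoherent = λ φ v →
        Tm-cong {α = α} {β = α [ ψ ]ʳ} (λ χ → subst (λ χ′ → α χ′ _ _) (∙-assoc ψ φ χ))
          (D.valueCoherent (ψ ∙ φ) v)
    }
    where module D = Denotes D

  ≐∶-[] : {M M′ A : Closed Ψ} → M ≐ M′ ∶ A → (ψ : Sub Ψ′ Ψ) → M [ ψ ] ≐ M′ [ ψ ] ∶ A [ ψ ]
  ≐∶-[] (α , D , t) ψ =
    α [ ψ ]ʳ , Denotes-[] D ψ ,
    Tm-cong {α = α} {β = α [ ψ ]ʳ}
      (λ χ → subst (λ φ → α φ _ _)
               (trans (∙-assoc idˢ ψ χ)
                 (trans (∙-identityˡ _) (cong (ψ ∙_) (sym (∙-identityˡ χ))))))
      (Tm-[] {α = α} t ψ)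

  -- The type changes along with the order because reversing two index lists also replaces the
  -- instance `A ⟦ I ⟧` by `A ⟦ I′ ⟧`. Equal types share a denotation, which is a PER.
  ≐∶-sym : {M M′ A A′ : Closed Ψ} → A ≐ A′ type-pre → M ≐ M′ ∶ A → M′ ≐ M ∶ A′
  ≐∶-sym (β , E) (α , D , t) =
    β , Denotes-reflʳ E ,
    Tm-cong {α = α} {β = β} (λ χ → proj₁ (Denotes-unique D E (idˢ ∙ χ)))
      (Tm-sym {α = α} (Denotes-PER D) t)

  ≐∶⃗-[] : {Δ : Telescope Ψ n} {I I′ : Vec (Closed Ψ) n} → I ≐ I′ ∶⃗ Δ →
          (ψ : Sub Ψ′ Ψ) → I [ ψ ]⃗ ≐ I′ [ ψ ]⃗ ∶⃗ Δ [ ψ ]ᵗ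
  ≐∶⃗-[] []                              ψ = []
  ≐∶⃗-[] (_∷_ {I = I} {A = A} M≐M′ I≐I′) ψ =
    subst (_ ≐ _ ∶_) (⟦⟧-[] A I ψ) (≐∶-[] M≐M′ ψ) ∷ ≐∶⃗-[] I≐I′ ψ

  ≐∶⃗-[]-∙ : {Δ : Telescope Ψ n} {ψ : Sub Ψ′ Ψ} {I I′ : Vec (Closed Ψ′) n} →
            I ≐ I′ ∶⃗ Δ [ ψ ]ᵗ → (χ : Sub Ψ″ Ψ′) → I [ χ ]⃗ ≐ I′ [ χ ]⃗ ∶⃗ Δ [ ψ ∙ χ ]ᵗ
  ≐∶⃗-[]-∙ {Δ = Δ} {ψ} I≐I′ χ = subst (_ ≐ _ ∶⃗_) ([]ᵗ-∙ Δ ψ χ) (≐∶⃗-[] I≐I′ χ)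

  -- Types are instantiated at the left list, which stays in place, so each entry is handled at its
  -- own type.
  ≐∶⃗-reflˡ : {Δ : Telescope Ψ n} {I I′ : Vec (Closed Ψ) n} → I ≐ I′ ∶⃗ Δ → I ≐ I ∶⃗ Δ
  ≐∶⃗-reflˡ []                       = []
  ≐∶⃗-reflˡ ((α , D , t) ∷ I≐I′) = (α , D , Tm-reflˡ {α = α} t) ∷ ≐∶⃗-reflˡ I≐I′

  -- Well-formedness of `Δ` enters here: functionality of each type at `I≐I′` provides the type
  -- equality for `≐∶-sym`.
  ≐∶⃗-sym : {Δ : Telescope Ψ n} → Δ ctx-Kan → (ψ : Sub Ψ′ Ψ) {I I′ : Vec (Closed Ψ′) n} →
           I ≐ I′ ∶⃗ Δ [ ψ ]ᵗ → I′ ≐ I ∶⃗ Δ [ ψ ]ᵗ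
  ≐∶⃗-sym ∅         ψ []            = []
  ≐∶⃗-sym (Δ-Kan ▹ A-Kan) ψ (M≐M′ ∷ I≐I′) with A-Kan ψ I≐I′
  ... | (α , D , _) = ≐∶-sym (α , D) M≐M′ ∷ ≐∶⃗-sym Δ-Kan ψ I≐I′

  -- Indexed relations and the behaviour of `fcoe`.

  module _ {a : Level} {Δ : Telescope Ψ n} {α : Family a Ψ n} where

    endpoint : {ψ : Sub Ψ′ Ψ} {I I′ : Vec (Closed (suc Ψ′)) n} → I ≐ I′ ∶⃗ Δ [ ψ ∙ π ]ᵗ →
               (r : Dim Ψ′) → I [ ⟨ r /y⟩ ]⃗ ≐ I′ [ ⟨ r /y⟩ ]⃗ ∶⃗ Δ [ ψ ]ᵗ
    endpoint {ψ = ψ} I≐I′ r =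
      subst (λ φ → _ ≐ _ ∶⃗ Δ [ φ ]ᵗ) (∙-π-∙-⟨/y⟩ ψ r) (≐∶⃗-[]-∙ {Δ = Δ} I≐I′ ⟨ r /y⟩)

    -- Naturality turns the `χ` part of each component into an identity component at `ψ ∙ χ`, where
    -- the substituted endpoints are literally the same list.
    component-degenerate :
      IsIndexed Δ α → (ψ : Sub Ψ′ Ψ) (I : Vec (Closed (suc Ψ′)) n) → I ≐ I ∶⃗ Δ [ ψ ∙ π ]ᵗ →
      (r r′ : Dim Ψ′) (χ : Sub Ψ″ Ψ′) → Degenerate n (r [ χ ]ᵈ) (r′ [ χ ]ᵈ) →
      α ψ (I [ ⟨ r /y⟩ ]⃗) χ ⇒ α ψ (I [ ⟨ r′ /y⟩ ]⃗) χ
    component-degenerate ix ψ I I≐I r r′ χ deg {N} {N′} =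
      subst (λ φ → α ψ _ φ N N′) (∙-identityʳ χ) ∘
      proj₂ (natural ψ (endpoint I≐I r′) χ idˢ) ∘
      subst (λ J → α (ψ ∙ χ) J idˢ N N′) endpoints≡ ∘
      proj₁ (natural ψ (endpoint I≐I r) χ idˢ) ∘
      subst (λ φ → α ψ _ φ N N′) (sym (∙-identityʳ χ))
      where
      open IsIndexed ix
      endpoints≡ : I [ ⟨ r /y⟩ ]⃗ [ χ ]⃗ ≡ I [ ⟨ r′ /y⟩ ]⃗ [ χ ]⃗
      endpoints≡ = trans (⟨/y⟩-[] I r χ)
                     (trans (degenerate-endpoints (I [ liftˢ 1 χ ]⃗) deg) (sym (⟨/y⟩-[] I r′ χ)))

    -- The premises of `fcoe-rel` are all stable under `χ`, with `I [ liftˢ 1 χ ]⃗` as the line of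
    -- indices. The target `K` is kept separate so that a line starting from `I′` can still land at
    -- the endpoint of `I`.
    Fcoe-intro :
      IsIndexed Δ α → (ψ : Sub Ψ′ Ψ) {I I′ : Vec (Closed (suc Ψ′)) n} {K : Vec (Closed Ψ′) n}
      {r r′ : Dim Ψ′} {M M′ : Closed Ψ′} →
      I ≐ I′ ∶⃗ Δ [ ψ ∙ π ]ᵗ → I [ ⟨ r′ /y⟩ ]⃗ ≐ K ∶⃗ Δ [ ψ ]ᵗ →
      Tm (α ψ (I [ ⟨ r /y⟩ ]⃗)) idˢ M M′ →
      (χ : Sub Ψ″ Ψ′) → ¬ Degenerate n (r [ χ ]ᵈ) (r′ [ χ ]ᵈ) →
      Fcoe Δ α ψ K χ (fcoe I r r′ M [ χ ]) (fcoe I′ r r′ M′ [ χ ])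
    Fcoe-intro ix ψ {I} {I′} {K} {r} {r′} {M} {M′} I≐I′ I⟨r′⟩≐K t χ ¬deg =
      subst₂ (Fcoe Δ α ψ K χ) (sym (fcoe-[] I r r′ M χ)) (sym (fcoe-[] I′ r r′ M′ χ))
        (fcoe-rel (¬deg ∘ inj₁) (¬deg ∘ inj₂) J≐J′ J⟨r′⟩≐K Mχ≐M′χ)
      where
      J≐J′ : I [ liftˢ 1 χ ]⃗ ≐ I′ [ liftˢ 1 χ ]⃗ ∶⃗ Δ [ (ψ ∙ χ) ∙ π ]ᵗ
      J≐J′ = subst (λ φ → _ ≐ _ ∶⃗ Δ [ φ ]ᵗ)
        (trans (∙-assoc ψ π _) (trans (cong (ψ ∙_) (π-∙-∷ _ _)) (sym (∙-assoc ψ χ π))))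
        (≐∶⃗-[]-∙ {Δ = Δ} I≐I′ (liftˢ 1 χ))
      J⟨r′⟩≐K : I [ liftˢ 1 χ ]⃗ [ ⟨ r′ [ χ ]ᵈ /y⟩ ]⃗ ≐ K [ χ ]⃗ ∶⃗ Δ [ ψ ∙ χ ]ᵗ
      J⟨r′⟩≐K = subst (_≐ _ ∶⃗ _) (⟨/y⟩-[] I r′ χ) (≐∶⃗-[]-∙ {Δ = Δ} I⟨r′⟩≐K χ)
      at : Vec (Closed _) n → ΨRel a _
      at = α (ψ ∙ χ)
      -- Naturality carries the premise from `α ψ` to `α (ψ ∙ χ)`; then the endpoint is commuted
      -- with `χ`.
      Mχ≐M′χ : Tm (at (I [ liftˢ 1 χ ]⃗ [ ⟨ r [ χ ]ᵈ /y⟩ ]⃗)) idˢ (M [ χ ]) (M′ [ χ ])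
      Mχ≐M′χ = subst (λ J → Tm (at J) idˢ (M [ χ ]) (M′ [ χ ])) (⟨/y⟩-[] I r χ)
        (Tm-cong {α = α ψ (I [ ⟨ r /y⟩ ]⃗)} {β = at (I [ ⟨ r /y⟩ ]⃗ [ χ ]⃗)}
          (λ φ {N} {N′} →
            subst (λ φ′ → at _ φ′ N N′) (sym (∙-identityˡ φ)) ∘
            proj₁ (IsIndexed.natural ix ψ (endpoint (≐∶⃗-reflˡ I≐I′) r) χ φ) ∘
            subst (λ χ′ → α ψ _ (χ′ ∙ φ) N N′) (∙-identityˡ χ))
          (Tm-[] {α = α ψ (I [ ⟨ r /y⟩ ]⃗)} t χ))

    module _ (Δ-Kan : Δ ctx-Kan) (α-per : ValueIndexedPER Δ α) {ψ : Sub Ψ′ Ψ} {r r′ : Dim Ψ′}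
             {I I′ : Vec (Closed (suc Ψ′)) n} {M M′ : Closed Ψ′}
             (I≐I′ : I ≐ I′ ∶⃗ Δ [ ψ ∙ π ]ᵗ)
             (t : Tm (α ψ (I [ ⟨ r /y⟩ ]⃗)) idˢ M M′) where
      open ValueIndexedPER α-per

      private
        αʳ αʳ′ : ΨRel a Ψ′
        αʳ  = α ψ (I [ ⟨ r /y⟩ ]⃗)
        αʳ′ = α ψ (I [ ⟨ r′ /y⟩ ]⃗)

        Deg : Sub Ψ″ Ψ′ → Set
        Deg χ = Degenerate n (r [ χ ]ᵈ) (r′ [ χ ]ᵈ)

        F F′ : Closed Ψ′
        F  = fcoe I r r′ M
        F′ = fcoe I′ r r′ M′

        I≐I : I ≐ I ∶⃗ Δ [ ψ ∙ π ]ᵗ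
        I≐I = ≐∶⃗-reflˡ I≐I′

        αʳ⇒αʳ′ : (χ : Sub Ψ″ Ψ′) → Deg χ → αʳ χ ⇒ αʳ′ χ
        αʳ⇒αʳ′ = component-degenerate indexed ψ I I≐I r r′

      -- With no indices, `F` is a head expansion of `M` under every substitution, and the two
      -- endpoints are both the empty list.
      fcoe-empty : n ≡ 0 → Tm αʳ′ idˢ F M
      fcoe-empty n≡0 =
        Tm-map {α = αʳ} {β = αʳ′} {M = M} {M} {F} {M}
          (λ χ → αʳ⇒αʳ′ (idˢ ∙ χ) (inj₁ n≡0))
          (λ χ → fcoe-degenerate I r r′ M χ (inj₁ n≡0)) (λ _ → id)
          (Tm-reflˡ {α = αʳ} t)

      -- Once `χ` identifies `r` and `r′`, every further `φ` does too, so the head expansion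
      -- argument applies to all instances of `F [ χ ]`.
      fcoe-diagonal : Under (Tm αʳ′) idˢ ((r , r′) ∷ []) F M
      fcoe-diagonal χ (rχ≡r′χ ∷ []) =
        Tm-map {α = αʳ} {β = αʳ′} {M = M [ χ ]} {M [ χ ]} {F [ χ ]} {M [ χ ]}
          (λ φ → αʳ⇒αʳ′ ((idˢ ∙ χ) ∙ φ)
                   (subst (λ χ′ → Deg (χ′ ∙ φ)) (sym (∙-identityˡ χ)) (deg φ)))
          (λ φ → ⊑-[]-∙ M F χ φ (fcoe-degenerate I r r′ M (χ ∙ φ) (deg φ))) (λ _ → id)
          (Tm-[] {α = αʳ} (Tm-reflˡ {α = αʳ} t) χ)
        where
        deg : (φ : Sub Φ _) → Deg (χ ∙ φ)
        deg φ = degenerate-∙ r r′ χ φ (inj₂ rχ≡r′χ)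

      fcoe-cong : Tm ((α ∪ Fcoe Δ α) ψ (I [ ⟨ r′ /y⟩ ]⃗)) idˢ F F′
      fcoe-cong = coherent⇒Tm-id {α = R} coherent
        where
        R : ΨRel _ Ψ′
        R = (α ∪ Fcoe Δ α) ψ (I [ ⟨ r′ /y⟩ ]⃗)

        I′≐I : I′ ≐ I ∶⃗ Δ [ ψ ∙ π ]ᵗ
        I′≐I = ≐∶⃗-sym Δ-Kan (ψ ∙ π) I≐I′

        -- Relating `F′` to itself through `fcoe-rel` requires its argument at the start of `I′`,
        -- whereas `t` lives at the start of `I`.
        t′ : Tm (α ψ (I′ [ ⟨ r /y⟩ ]⃗)) idˢ M′ M′
        t′ = Tm-cong {α = αʳ} {β = α ψ (I′ [ ⟨ r /y⟩ ]⃗)}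
               (λ χ → proj₁ (IsIndexed.respects indexed ψ (endpoint I≐I′ r) (idˢ ∙ χ)))
               (Tm-reflʳ {α = αʳ} t)

        -- When `N [ ψ₁ ]` is its own value, evaluating it after `ψ₂` is the direct evaluation, so
        -- one derivation serves twice.
        evaluations : (N : Closed Ψ′) (ψ₁ : Sub Ψ₁ Ψ′) (ψ₂ : Sub Ψ₂ Ψ₁) {V : Closed Ψ₂} →
                      N [ ψ₁ ] ⇓ N [ ψ₁ ] → N [ ψ₁ ∙ ψ₂ ] ⇓ V → Evaluations N ψ₁ ψ₂
        evaluations N ψ₁ ψ₂ ⇓₁ ⇓₁₂ = record { ⇓M₁ = ⇓₁ ; ⇓M₂ = ⇓₁₂′ ; ⇓M₁₂ = ⇓₁₂′ }
          where ⇓₁₂′ = subst (_⇓ _) (sym ([]-∙ N ψ₁ ψ₂)) ⇓₁₂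

        coherent : (ψ₁ : Sub Ψ₁ Ψ′) (ψ₂ : Sub Ψ₂ Ψ₁) → CoherentAt R F F′ ψ₁ ψ₂
        coherent ψ₁ ψ₂ with degenerate? n (r [ ψ₁ ]ᵈ) (r′ [ ψ₁ ]ᵈ)
                          | degenerate? n (r [ ψ₁ ∙ ψ₂ ]ᵈ) (r′ [ ψ₁ ∙ ψ₂ ]ᵈ)
        -- All three evaluations of `F` factor through those of `M`, so the coherence of `M` and
        -- `M′` is transported as it stands.
        ... | yes deg₁ | _ =
          coherent-map {R = αʳ} {R′ = R} {M = M} {M′} {F} {F′}
            (inj₁ ∘ αʳ⇒αʳ′ (ψ₁ ∙ ψ₂) deg)
            (fcoe-degenerate I r r′ M ψ₁ deg₁)
            (⊑-[]-∙ M F ψ₁ ψ₂ (fcoe-degenerate I r r′ M (ψ₁ ∙ ψ₂) deg))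
            (fcoe-degenerate I′ r r′ M′ ψ₁ deg₁)
            (⊑-[]-∙ M′ F′ ψ₁ ψ₂ (fcoe-degenerate I′ r r′ M′ (ψ₁ ∙ ψ₂) deg))
            (Tm-id⇒coherent {α = αʳ} t ψ₁ ψ₂)
          where
          deg : Deg (ψ₁ ∙ ψ₂)
          deg = degenerate-∙ r r′ ψ₁ ψ₂ deg₁
        ... | no ¬deg₁ | yes deg = record
          { eval   = evaluations F ψ₁ ψ₂ (fcoe-nondegenerate I r r′ M ψ₁ ¬deg₁)
                       (fcoe-degenerate I r r′ M (ψ₁ ∙ ψ₂) deg
                         (subst (_⇓ C.M₁₂) ([]-∙ M ψ₁ ψ₂) C.⇓M₁₂))
          ; eval′  = evaluations F′ ψ₁ ψ₂ (fcoe-nondegenerate I′ r r′ M′ ψ₁ ¬deg₁)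
                       (fcoe-degenerate I′ r r′ M′ (ψ₁ ∙ ψ₂) deg
                         (subst (_⇓ C.M₁₂′) ([]-∙ M′ ψ₁ ψ₂) C.⇓M₁₂′))
          -- The only values reached are direct evaluations at `χ`, so the pair needed is `M₁₂`,
          -- `M₁₂′`, which the PER structure of `α` provides.
          ; across = inj₁ (αʳ⇒αʳ′ χ deg (across₁₂ {R = αʳ} c (per ψ (endpoint I≐I r) χ)))
          ; left   = among-const {R = R χ}
                       (inj₁ (αʳ⇒αʳ′ χ deg (C.left (there (here refl)) (there (here refl)))))
          ; right  = among-const {R = R χ}
                       (inj₁ (αʳ⇒αʳ′ χ deg (C.right (there (here refl)) (there (here refl)))))
          }
          where
          χ : Sub _ Ψ′
          χ = ψ₁ ∙ ψ₂
          c = Tm-id⇒coherent {α = αʳ} t ψ₁ ψ₂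
          module C = CoherentAt c
        ... | no ¬deg₁ | no ¬deg = record
          { eval   = evaluations F ψ₁ ψ₂ (fcoe-nondegenerate I r r′ M ψ₁ ¬deg₁)
                       (fcoe-nondegenerate I r r′ M χ ¬deg)
          ; eval′  = evaluations F′ ψ₁ ψ₂ (fcoe-nondegenerate I′ r r′ M′ ψ₁ ¬deg₁)
                       (fcoe-nondegenerate I′ r r′ M′ χ ¬deg)
          ; across = inj₂ (Fcoe-intro indexed ψ I≐I′ (endpoint I≐I r′) t χ ¬deg)
          ; left   = among-const {R = R χ}
                       (inj₂ (Fcoe-intro indexed ψ I≐I (endpoint I≐I r′) (Tm-reflˡ {α = αʳ} t) χ ¬deg))
          ; right  = among-const {R = R χ}
                       -- The generating line is now `I′`, but the component is still taken at the
                       -- endpoint of `I`; the reversed equality `I′≐I` bridges the two.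
                       (inj₂ (Fcoe-intro indexed ψ (≐∶⃗-reflˡ I′≐I) (endpoint I′≐I r′) t′ χ ¬deg))
          }
          where
          χ : Sub _ Ψ′
          χ = ψ₁ ∙ ψ₂

lemma4p14 : {ℓ ℓ′ a : Level} (S : Signature) (O : OperationalSemantics S)
    (T : Relations.CubicalTypeSystem O ℓ ℓ′) →
    let open Syntax S
        open Relations O
        open Judgments T
    in
    (Ψ n : ℕ) (Δ : Telescope Ψ n) → Δ ctx-Kan →
    (α : Family a Ψ n) → ValueIndexedPER Δ α →
    (Ψ′ : ℕ) (ψ : Sub Ψ′ Ψ) (r r′ : Dim Ψ′)
    (I I′ : Vec (Closed (suc Ψ′)) n) (M M′ : Closed Ψ′) →
    I ≐ I′ ∶⃗ Δ [ ψ ∙ π ]ᵗ →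
    Tm (α ψ (I [ ⟨ r /y⟩ ]⃗)) idˢ M M′ →
      (n ≡ 0 → Tm (α ψ (I [ ⟨ r′ /y⟩ ]⃗)) idˢ (fcoe I r r′ M) M)
    × Under (Tm (α ψ (I [ ⟨ r′ /y⟩ ]⃗))) idˢ ((r , r′) ∷ []) (fcoe I r r′ M) M
    × Tm ((α ∪ Fcoe Δ α) ψ (I [ ⟨ r′ /y⟩ ]⃗)) idˢ (fcoe I r r′ M) (fcoe I′ r r′ M′)
lemma4p14 S O T Ψ n Δ Δ-Kan α α-per Ψ′ ψ r r′ I I′ M M′ I≐I′ t =
    fcoe-empty {α = α} Δ-Kan α-per I≐I′ t
  , fcoe-diagonal {α = α} Δ-Kan α-per I≐I′ t
  , fcoe-cong {α = α} Δ-Kan α-per I≐I′ t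
  where open Typing T
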